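{- The first-order theory of the structure $\langle\mathbb{Z},\cdot,\leqslant\rangle$ is undecidable; that is, there is no algorithm which, given a first-order sentence in the language $\{\cdot,\leqslant\}$, decides whether it is true in $\langle\mathbb{Z},\cdot,\leqslant\rangle$.
   Context: $\langle\mathbb{Z},\cdot,\leqslant\rangle$ is the first-order structure whose domain is the set of integers, with the usual multiplication and the usual (non-strict) order. -}

module Defs where

open import Data.Fin.Base using (Fin; toℕ)
open import Data.Fin.Properties using (toℕ-injective)
open import Data.Integer.Base as ℤ using (ℤ)
import Data.Integer.Properties as ℤ
open import Data.Nat.Base using (ℕ; suc; _+_; _*_; _<_)
open import Data.Nat.Properties
open import Data.Product.Base using (_×_; _,_; ∃)
open import Data.Vec.Base using (Vec; []; _∷_; lookup)
open import Data.Vec.Relation.Binary.Pointwise.Inductive using (Pointwise)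
open import Relation.Binary.Definitions using (tri<; tri≈; tri>)
open import Relation.Binary.PropositionalEquality
open import Relation.Nullary using (¬_; contradiction)
open import Relation.Nullary.Decidable using (decidable-stable)

------------------------------------------------------------------------
-- First-order language {·, ≤} with equality

-- Variables are de Bruijn indices: Term n and Formula n have their free
-- variables among n, and a quantifier binds index 0.

infixl 7 _·_
infix  6 _≐_ _≼_
infixr 3 _⇒_
infixr 5 _∧_
infixr 4 _∨_

data Term (n : ℕ) : Set where
  var : Fin n → Term n
  _·_ : Term n → Term n → Term n

-- The primitive logical symbols are =, ¬, → and ∀. The other connectives
-- are the usual classical abbreviations, which makes Agda's reading of
-- truth below agree with classical truth (see ⊨-stable).

data Formula (n : ℕ) : Set where
  _≐_  : Term n → Term n → Formula n
  _≼_  : Term n → Term n → Formula n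
  neg  : Formula n → Formula n
  _⇒_  : Formula n → Formula n → Formula n
  all  : Formula (suc n) → Formula n

_∧_ _∨_ : ∀ {n} → Formula n → Formula n → Formula n
φ ∧ ψ = neg (φ ⇒ neg ψ)
φ ∨ ψ = neg φ ⇒ ψ

ex : ∀ {n} → Formula (suc n) → Formula n
ex φ = neg (all (neg φ))

Sentence : Set
Sentence = Formula 0

------------------------------------------------------------------------
-- Truth in ⟨ℤ, ·, ≤⟩

⟦_⟧ : ∀ {n} → Term n → Vec ℤ n → ℤ
⟦ var i ⟧ ρ = lookup ρ i
⟦ s · t ⟧ ρ = ⟦ s ⟧ ρ ℤ.* ⟦ t ⟧ ρ

infix 2 _⊨_

_⊨_ : ∀ {n} → Vec ℤ n → Formula n → Set
ρ ⊨ s ≐ t  = ⟦ s ⟧ ρ ≡ ⟦ t ⟧ ρ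
ρ ⊨ s ≼ t  = ⟦ s ⟧ ρ ℤ.≤ ⟦ t ⟧ ρ
ρ ⊨ neg φ  = ¬ (ρ ⊨ φ)
ρ ⊨ φ ⇒ ψ  = ρ ⊨ φ → ρ ⊨ ψ
ρ ⊨ all φ  = (x : ℤ) → x ∷ ρ ⊨ φ

⊨-stable : ∀ {n} (φ : Formula n) (ρ : Vec ℤ n) → ¬ ¬ (ρ ⊨ φ) → ρ ⊨ φ
⊨-stable (s ≐ t) ρ h   = decidable-stable (⟦ s ⟧ ρ ℤ.≟ ⟦ t ⟧ ρ) h
⊨-stable (s ≼ t) ρ h   = decidable-stable (⟦ s ⟧ ρ ℤ.≤? ⟦ t ⟧ ρ) h
⊨-stable (neg φ) ρ h   = λ p → h (λ np → np p)
⊨-stable (φ ⇒ ψ) ρ h p = ⊨-stable ψ ρ (λ nq → h (λ f → nq (f p)))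
⊨-stable (all φ) ρ h x = ⊨-stable φ (x ∷ ρ) (λ nq → h (λ f → nq (f x)))

True : Sentence → Set
True φ = [] ⊨ φ

------------------------------------------------------------------------
-- Gödel numbering

-- Injective because a ≤ a + b: the square root of ⟨ a , b ⟩, rounded
-- down, is a + b.
⟨_,_⟩ : ℕ → ℕ → ℕ
⟨ a , b ⟩ = (a + b) * (a + b) + a

⌜_⌝ᵗ : ∀ {n} → Term n → ℕ
⌜ var i ⌝ᵗ = ⟨ 0 , toℕ i ⟩
⌜ s · t ⌝ᵗ = ⟨ 1 , ⟨ ⌜ s ⌝ᵗ , ⌜ t ⌝ᵗ ⟩ ⟩

⌜_⌝ : ∀ {n} → Formula n → ℕ
⌜ s ≐ t ⌝ = ⟨ 0 , ⟨ ⌜ s ⌝ᵗ , ⌜ t ⌝ᵗ ⟩ ⟩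
⌜ s ≼ t ⌝ = ⟨ 1 , ⟨ ⌜ s ⌝ᵗ , ⌜ t ⌝ᵗ ⟩ ⟩
⌜ neg φ ⌝ = ⟨ 2 , ⌜ φ ⌝ ⟩
⌜ φ ⇒ ψ ⌝ = ⟨ 3 , ⟨ ⌜ φ ⌝ , ⌜ ψ ⌝ ⟩ ⟩
⌜ all φ ⌝ = ⟨ 4 , ⌜ φ ⌝ ⟩

private
  gap : ∀ a b c d → a + b < c + d → ⟨ a , b ⟩ < ⟨ c , d ⟩
  gap a b c d lt = begin-strict
    (a + b) * (a + b) + a        ≤⟨ +-monoʳ-≤ ((a + b) * (a + b)) (m≤m+n a b) ⟩
    (a + b) * (a + b) + (a + b)  ≡⟨ +-comm ((a + b) * (a + b)) (a + b) ⟩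
    suc (a + b) * (a + b)        <⟨ *-monoʳ-< (suc (a + b)) (n<1+n (a + b)) ⟩
    suc (a + b) * suc (a + b)    ≤⟨ *-mono-≤ lt lt ⟩
    (c + d) * (c + d)            ≤⟨ m≤m+n _ c ⟩
    (c + d) * (c + d) + c        ∎
    where open ≤-Reasoning

⟨,⟩-injective : ∀ a b c d → ⟨ a , b ⟩ ≡ ⟨ c , d ⟩ → a ≡ c × b ≡ d
⟨,⟩-injective a b c d eq with <-cmp (a + b) (c + d)
... | tri< lt _ _ = contradiction eq (<⇒≢ (gap a b c d lt))
... | tri> _ _ gt = contradiction (sym eq) (<⇒≢ (gap c d a b gt))
... | tri≈ _ s≡s′ _ = a≡c , +-cancelˡ-≡ a b d (trans s≡s′ (cong (_+ d) (sym a≡c)))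
  where
  a≡c : a ≡ c
  a≡c = +-cancelˡ-≡ ((a + b) * (a + b)) a c
          (trans eq (cong (λ s → s * s + c) (sym s≡s′)))

private
  tagᵗ bodyᵗ : ∀ {n} → Term n → ℕ
  tagᵗ (var i) = 0
  tagᵗ (s · t) = 1
  bodyᵗ (var i) = toℕ i
  bodyᵗ (s · t) = ⟨ ⌜ s ⌝ᵗ , ⌜ t ⌝ᵗ ⟩

  splitᵗ : ∀ {n} (t : Term n) → ⟨ tagᵗ t , bodyᵗ t ⟩ ≡ ⌜ t ⌝ᵗ
  splitᵗ (var i) = refl
  splitᵗ (s · t) = refl

  tag body : ∀ {n} → Formula n → ℕ
  tag (s ≐ t) = 0
  tag (s ≼ t) = 1
  tag (neg φ) = 2
  tag (φ ⇒ ψ) = 3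
  tag (all φ) = 4
  body (s ≐ t) = ⟨ ⌜ s ⌝ᵗ , ⌜ t ⌝ᵗ ⟩
  body (s ≼ t) = ⟨ ⌜ s ⌝ᵗ , ⌜ t ⌝ᵗ ⟩
  body (neg φ) = ⌜ φ ⌝
  body (φ ⇒ ψ) = ⟨ ⌜ φ ⌝ , ⌜ ψ ⌝ ⟩
  body (all φ) = ⌜ φ ⌝

  split : ∀ {n} (φ : Formula n) → ⟨ tag φ , body φ ⟩ ≡ ⌜ φ ⌝
  split (s ≐ t) = refl
  split (s ≼ t) = refl
  split (neg φ) = refl
  split (φ ⇒ ψ) = refl
  split (all φ) = refl

mutual
  ⌜⌝ᵗ-injective : ∀ {n} (s t : Term n) → ⌜ s ⌝ᵗ ≡ ⌜ t ⌝ᵗ → s ≡ t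
  ⌜⌝ᵗ-injective s t eq =
    let p , q = ⟨,⟩-injective (tagᵗ s) (bodyᵗ s) (tagᵗ t) (bodyᵗ t)
                  (trans (splitᵗ s) (trans eq (sym (splitᵗ t))))
    in matchᵗ s t p q

  private
    matchᵗ : ∀ {n} (s t : Term n) → tagᵗ s ≡ tagᵗ t → bodyᵗ s ≡ bodyᵗ t → s ≡ t
    matchᵗ (var i) (var j) _ q = cong var (toℕ-injective q)
    matchᵗ (s · t) (u · v) _ q =
      let q₁ , q₂ = ⟨,⟩-injective ⌜ s ⌝ᵗ ⌜ t ⌝ᵗ ⌜ u ⌝ᵗ ⌜ v ⌝ᵗ q
      in cong₂ _·_ (⌜⌝ᵗ-injective s u q₁) (⌜⌝ᵗ-injective t v q₂)

mutual
  ⌜⌝-injective : ∀ {n} (φ ψ : Formula n) → ⌜ φ ⌝ ≡ ⌜ ψ ⌝ → φ ≡ ψ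
  ⌜⌝-injective φ ψ eq =
    let p , q = ⟨,⟩-injective (tag φ) (body φ) (tag ψ) (body ψ)
                  (trans (split φ) (trans eq (sym (split ψ))))
    in match φ ψ p q

  private
    match : ∀ {n} (φ ψ : Formula n) → tag φ ≡ tag ψ → body φ ≡ body ψ → φ ≡ ψ
    match (s ≐ t) (u ≐ v) _ q =
      let q₁ , q₂ = ⟨,⟩-injective ⌜ s ⌝ᵗ ⌜ t ⌝ᵗ ⌜ u ⌝ᵗ ⌜ v ⌝ᵗ q
      in cong₂ _≐_ (⌜⌝ᵗ-injective s u q₁) (⌜⌝ᵗ-injective t v q₂)
    match (s ≼ t) (u ≼ v) _ q =
      let q₁ , q₂ = ⟨,⟩-injective ⌜ s ⌝ᵗ ⌜ t ⌝ᵗ ⌜ u ⌝ᵗ ⌜ v ⌝ᵗ q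
      in cong₂ _≼_ (⌜⌝ᵗ-injective s u q₁) (⌜⌝ᵗ-injective t v q₂)
    match (neg φ) (neg ψ) _ q = cong neg (⌜⌝-injective φ ψ q)
    match (φ ⇒ ψ) (χ ⇒ θ) _ q =
      let q₁ , q₂ = ⟨,⟩-injective ⌜ φ ⌝ ⌜ ψ ⌝ ⌜ χ ⌝ ⌜ θ ⌝ q
      in cong₂ _⇒_ (⌜⌝-injective φ χ q₁) (⌜⌝-injective ψ θ q₂)
    match (all φ) (all ψ) _ q = cong all (⌜⌝-injective φ ψ q)

------------------------------------------------------------------------
-- Algorithms: partial recursive functions

data Rec : ℕ → Set where
  zer  : Rec 0
  succ : Rec 1
  proj : ∀ {n} → Fin n → Rec n
  comp : ∀ {m n} → Rec m → Vec (Rec n) m → Rec n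
  prec : ∀ {n} → Rec n → Rec (2 + n) → Rec (1 + n)
  mu   : ∀ {n} → Rec (1 + n) → Rec n

-- f [ xs ]⇓ y: the computation of f on xs halts with value y.

infix 4 _[_]⇓_

data _[_]⇓_ : ∀ {n} → Rec n → Vec ℕ n → ℕ → Set where
  zer⇓   : zer [ [] ]⇓ 0
  succ⇓  : ∀ {x} → succ [ x ∷ [] ]⇓ suc x
  proj⇓  : ∀ {n} {i : Fin n} {xs} → proj i [ xs ]⇓ lookup xs i
  comp⇓  : ∀ {m n} {f : Rec m} {gs : Vec (Rec n) m} {xs ys z} →
           Pointwise (λ g y → g [ xs ]⇓ y) gs ys → f [ ys ]⇓ z →
           comp f gs [ xs ]⇓ z
  prec⇓₀ : ∀ {n} {f : Rec n} {g xs y} →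
           f [ xs ]⇓ y → prec f g [ 0 ∷ xs ]⇓ y
  prec⇓₊ : ∀ {n} {f : Rec n} {g k xs r y} →
           prec f g [ k ∷ xs ]⇓ r → g [ k ∷ r ∷ xs ]⇓ y →
           prec f g [ suc k ∷ xs ]⇓ y
  mu⇓    : ∀ {n} {f : Rec (1 + n)} {xs y} →
           f [ y ∷ xs ]⇓ 0 →
           (∀ z → z < y → ∃ λ v → f [ z ∷ xs ]⇓ suc v) →
           mu f [ xs ]⇓ y

-- f decides P when, given the Gödel number of a sentence, it answers 1 if
-- P holds of the sentence and 0 if not. Nothing is required of f on
-- numbers that do not code a sentence.
_decides_ : Rec 1 → (Sentence → Set) → Set
f decides P = (φ : Sentence) →
  (P φ → f [ ⌜ φ ⌝ ∷ [] ]⇓ 1) × (¬ P φ → f [ ⌜ φ ⌝ ∷ [] ]⇓ 0)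

Undecidable : (Sentence → Set) → Set
Undecidable P = ¬ ∃ λ (f : Rec 1) → f decides P

{-# OPTIONS --safe #-}
module Submission where

-- Successor is definable from the order, and addition from successor and
-- multiplication (Robinson), so ⟨ℤ, ·, ≤⟩ interprets arithmetic on ℕ. There
-- the graph of every partial recursive function is definable. Let f decide
-- truth. The function taking the code of a formula φ(x) to the code of the
-- sentence φ(⌜φ⌝) is recursive, so "f(⌜x(x)⌝) = 0" is a formula; applied to
-- its own code, it is true exactly when f declares it false.

open import Defs

open import Algebra.Bundles using (AbelianGroup)
open import Algebra.Properties.Group using (∙-cancelˡ)
open import Data.Fin.Base using (Fin; zero; suc; _↑ˡ_; _↑ʳ_)
open import Data.Fin.Patterns using (0F; 1F; 2F; 3F; 4F; 5F; 6F)
open import Data.Integer.Base as ℤ using (ℤ; +_; -[1+_]; 0ℤ; 1ℤ)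
import Data.Integer.Properties as ℤ
import Data.Integer.Tactic.RingSolver as ℤSolver
open import Data.List.Base as List using (List; []; _∷_)
open import Data.List.Membership.Propositional using (_∈_)
open import Data.List.Membership.Propositional.Properties using (∈-map⁺)
open import Data.List.Relation.Unary.Any using (here; there)
open import Data.Nat.Base using (ℕ; zero; suc; _+_; _*_; _≤_; _<_; z≤n; s≤s; _!)
open import Data.Nat.Coprimality using (Coprime; coprime-divisor)
import Data.Nat.Coprimality as Coprime
open import Data.Nat.Divisibility
open import Data.Nat.ListAction using (sum; product)
open import Data.Nat.ListAction.Properties using (∈⇒∣product)
open import Data.Nat.Properties
import Data.Nat.Tactic.RingSolver as ℕSolver
open import Data.Product.Base using (_×_; _,_; ∃; proj₁; proj₂)
open import Data.Vec.Base using (Vec; []; _∷_; lookup; _++_)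
open import Data.Vec.Properties using (lookup-++ˡ; lookup-++ʳ)
open import Data.Vec.Relation.Binary.Pointwise.Inductive using (Pointwise; []; _∷_)
import Data.Vec.Functional as Vector
open import Function.Base using (_∘_; id)
open import Function.Bundles using (_⇔_; mk⇔; Equivalence)
open import Relation.Binary.Definitions using (tri<; tri≈; tri>)
open import Relation.Binary.PropositionalEquality
open import Relation.Nullary using (¬_; yes; no; contradiction)
open import Relation.Nullary.Decidable using (decidable-stable)

open Equivalence using (to; from)

private
  variable
    k m n : ℕ

-- Successor and addition in ⟨ℤ, ·, ≤⟩

wk : Term n → Term (suc n)
wk (var i) = var (suc i)
wk (s · t) = wk s · wk t

⟦wk⟧ : ∀ (t : Term n) x ρ → ⟦ wk t ⟧ (x ∷ ρ) ≡ ⟦ t ⟧ ρ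
⟦wk⟧ (var i) x ρ = refl
⟦wk⟧ (s · t) x ρ = cong₂ ℤ._*_ (⟦wk⟧ s x ρ) (⟦wk⟧ t x ρ)

⊨-∧ : ∀ (φ ψ : Formula n) ρ → (ρ ⊨ φ ∧ ψ) ⇔ ((ρ ⊨ φ) × (ρ ⊨ ψ))
⊨-∧ φ ψ ρ = mk⇔
  (λ h → ⊨-stable φ ρ (λ ¬p → h (λ p → contradiction p ¬p))
       , ⊨-stable ψ ρ (λ ¬q → h (λ _ → ¬q)))
  (λ (p , q) h → h p q)

infix 6 _isZero _isSucOf_

_isZero : Term n → Formula n
t isZero = all (wk t · var 0F ≐ wk t)

⊨-isZero : ∀ (t : Term n) ρ → (ρ ⊨ t isZero) ⇔ (⟦ t ⟧ ρ ≡ 0ℤ)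
⊨-isZero t ρ = mk⇔
  (λ h → trans (sym (trans (h 0ℤ) (⟦wk⟧ t 0ℤ ρ))) (ℤ.*-zeroʳ (⟦ wk t ⟧ (0ℤ ∷ ρ))))
  (λ eq x → let eq′ = trans (⟦wk⟧ t x ρ) eq in
     trans (cong (ℤ._* x) eq′) (sym eq′))

-- The order on the integers is discrete, so the successor of `t` is the least element strictly
-- above it. Strict order is expressed as the negation of the reversed `≼`.
_isSucOf_ : Term n → Term n → Formula n
s isSucOf t = neg (s ≼ t) ∧ all (neg (wk s ≼ var 0F) ⇒ var 0F ≼ wk t)

⊨-isSucOf : ∀ (s t : Term n) ρ → (ρ ⊨ s isSucOf t) ⇔ (⟦ s ⟧ ρ ≡ ℤ.suc (⟦ t ⟧ ρ))
⊨-isSucOf s t ρ = mk⇔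
  (λ h → let s≰t , least = to conj h in ℤ.≤-antisym
     (decidable-stable (⟦ s ⟧ ρ ℤ.≤? ℤ.suc (⟦ t ⟧ ρ)) λ s≰t+1 →
        ℤ.<⇒≱ (ℤ.suc[i]≤j⇒i<j ℤ.≤-refl)
          (subst (ℤ.suc (⟦ t ⟧ ρ) ℤ.≤_) (⟦wk⟧ t _ ρ)
            (least (ℤ.suc (⟦ t ⟧ ρ)) (s≰t+1 ∘ subst (ℤ._≤ _) (⟦wk⟧ s _ ρ)))))
     (ℤ.i<j⇒suc[i]≤j (ℤ.≰⇒> s≰t)))
  (λ eq → from conj
     ( (λ s≤t → ℤ.<⇒≱ (ℤ.suc[i]≤j⇒i<j (ℤ.≤-reflexive (sym eq))) s≤t)
     , λ x s≰x → subst (x ℤ.≤_) (sym (⟦wk⟧ t x ρ)) (decidable-stable (x ℤ.≤? ⟦ t ⟧ ρ) λ x≰t →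
         s≰x (subst (ℤ._≤ x) (sym (trans (⟦wk⟧ s x ρ) eq)) (ℤ.i<j⇒suc[i]≤j (ℤ.≰⇒> x≰t))))))
  where
  conj = ⊨-∧ (neg (s ≼ t)) (all (neg (wk s ≼ var 0F) ⇒ var 0F ≼ wk t)) ρ

-- Robinson's definition of addition: for z ≠ 0, z = x + y if and only if
-- (1 + xz)(1 + yz) = 1 + z²(1 + xy).
robinson : Fin n → Fin n → Fin n → Formula n
robinson x y z =
  all (var 0F isSucOf var (1 ↑ʳ x) · var (1 ↑ʳ z) ⇒
  all (var 0F isSucOf var (2 ↑ʳ y) · var (2 ↑ʳ z) ⇒
  all (var 0F isSucOf var (3 ↑ʳ x) · var (3 ↑ʳ y) ⇒
  var 2F · var 1F isSucOf var (3 ↑ʳ z) · var (3 ↑ʳ z) · var 0F)))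

-- The inequalities handle z = 0, given that x and y are natural.
isSum : Fin n → Fin n → Fin n → Formula n
isSum x y z = (var x ≼ var z) ∧ (var y ≼ var z) ∧ robinson x y z

robinson-lhs : ∀ x y z → (1ℤ ℤ.+ x ℤ.* z) ℤ.* (1ℤ ℤ.+ y ℤ.* z) ≡
                         1ℤ ℤ.+ x ℤ.* y ℤ.* z ℤ.* z ℤ.+ z ℤ.* (x ℤ.+ y)
robinson-lhs = ℤSolver.solve-∀

robinson-rhs : ∀ x y z → 1ℤ ℤ.+ z ℤ.* z ℤ.* (1ℤ ℤ.+ x ℤ.* y) ≡
                         1ℤ ℤ.+ x ℤ.* y ℤ.* z ℤ.* z ℤ.+ z ℤ.* z
robinson-rhs = ℤSolver.solve-∀

-- The successor conditions determine the bound variables, so they can be instantiated with `U`, `V`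
-- and `W`. Both sides of Robinson's equation then expand to the common part `K` plus a multiple of
-- z, and `K` cancels. The remaining factor z may be 0, so it is kept.
⊨-robinson : ∀ (x y z : Fin n) ρ → (ρ ⊨ robinson x y z) ⇔
             (lookup ρ z ℤ.* (lookup ρ x ℤ.+ lookup ρ y) ≡ lookup ρ z ℤ.* lookup ρ z)
⊨-robinson x y z ρ = mk⇔
  (λ h → ∙-cancelˡ (AbelianGroup.group ℤ.+-0-abelianGroup) K _ _
     (trans (sym (robinson-lhs X Y Z))
       (trans (to (last U V W) (h U (from (first U) refl)
                                  V (from (second U V) refl)
                                  W (from (third U V W) refl)))
         (robinson-rhs X Y Z))))
  (λ eq u u≡ v v≡ w w≡ → from (last u v w)
     (trans (cong₂ ℤ._*_ (to (first u) u≡) (to (second u v) v≡))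
       (trans (robinson-lhs X Y Z)
         (trans (cong (λ t → K ℤ.+ t) eq)
           (trans (sym (robinson-rhs X Y Z))
             (cong (λ w → ℤ.suc (Z ℤ.* Z ℤ.* w)) (sym (to (third u v w) w≡))))))))
  where
  X = lookup ρ x
  Y = lookup ρ y
  Z = lookup ρ z
  U = ℤ.suc (X ℤ.* Z)
  V = ℤ.suc (Y ℤ.* Z)
  W = ℤ.suc (X ℤ.* Y)
  K = ℤ.suc (X ℤ.* Y ℤ.* Z ℤ.* Z)
  first  = λ u → ⊨-isSucOf (var 0F) (var (1 ↑ʳ x) · var (1 ↑ʳ z)) (u ∷ ρ)
  second = λ u v → ⊨-isSucOf (var 0F) (var (2 ↑ʳ y) · var (2 ↑ʳ z)) (v ∷ u ∷ ρ)
  third  = λ u v w → ⊨-isSucOf (var 0F) (var (3 ↑ʳ x) · var (3 ↑ʳ y)) (w ∷ v ∷ u ∷ ρ)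
  last   = λ u v w → ⊨-isSucOf (var 2F · var 1F) (var (3 ↑ʳ z) · var (3 ↑ʳ z) · var 0F)
                       (w ∷ v ∷ u ∷ ρ)

⊨-isSum : ∀ (x y z : Fin n) ρ {a b} → lookup ρ x ≡ + a → lookup ρ y ≡ + b →
          (ρ ⊨ isSum x y z) ⇔ (lookup ρ z ≡ + (a + b))
⊨-isSum x y z ρ {a} {b} x≡a y≡b = mk⇔
  (λ h → let x≤z , h′ = to conj h
             y≤z , r  = to conj′ h′ in
     unique (lookup ρ z) (subst (ℤ._≤ _) x≡a x≤z) (subst (ℤ._≤ _) y≡b y≤z)
       (trans (cong (lookup ρ z ℤ.*_) (sym x+y≡a+b)) (to (⊨-robinson x y z ρ) r)))
  (λ z≡ → from conj
     ( subst₂ ℤ._≤_ (sym x≡a) (sym z≡) (ℤ.+≤+ (m≤m+n a b))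
     , from conj′
       ( subst₂ ℤ._≤_ (sym y≡b) (sym z≡) (ℤ.+≤+ (m≤n+m b a))
       , from (⊨-robinson x y z ρ)
           (cong (lookup ρ z ℤ.*_) (trans x+y≡a+b (sym z≡))))))
  where
  conj  = ⊨-∧ (var x ≼ var z) ((var y ≼ var z) ∧ robinson x y z) ρ
  conj′ = ⊨-∧ (var y ≼ var z) (robinson x y z) ρ
  x+y≡a+b : lookup ρ x ℤ.+ lookup ρ y ≡ + (a + b)
  x+y≡a+b = cong₂ ℤ._+_ x≡a y≡b
  unique : ∀ z → + a ℤ.≤ z → + b ℤ.≤ z → z ℤ.* + (a + b) ≡ z ℤ.* z → z ≡ + (a + b)
  -- At z = 0 the inequalities force a = b = 0. Negative z is excluded since z is at least `+ a`,
  -- and for positive z the common factor cancels.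
  unique (+ zero)  (ℤ.+≤+ z≤n) (ℤ.+≤+ z≤n) _ = refl
  unique z@(+ suc _) _ _ eq = sym (ℤ.*-cancelˡ-≡ z (+ (a + b)) z eq)

-- First-order arithmetic and its translation into {·, ≤}

-- Conjunction can be primitive here: formulas are still stable, being
-- equivalent to their translations.

data Tm (n : ℕ) : Set where
  var     : Fin n → Tm n
  𝟘 𝟙     : Tm n
  _⊕_ _⊗_ : Tm n → Tm n → Tm n

infixl 8 _⊕_
infixl 9 _⊗_
infixr 5 _&_

data Fm (n : ℕ) : Set where
  _≐_ _≼_ : Tm n → Tm n → Fm n
  neg     : Fm n → Fm n
  _&_ _⇒_ : Fm n → Fm n → Fm n
  all     : Fm (suc n) → Fm n

eval : Tm n → Vec ℕ n → ℕ
eval (var i) ρ = lookup ρ i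
eval 𝟘       ρ = 0
eval 𝟙       ρ = 1
eval (s ⊕ t) ρ = eval s ρ + eval t ρ
eval (s ⊗ t) ρ = eval s ρ * eval t ρ

infix 2 _⊩_

_⊩_ : Vec ℕ n → Fm n → Set
ρ ⊩ s ≐ t  = eval s ρ ≡ eval t ρ
ρ ⊩ s ≼ t  = eval s ρ ≤ eval t ρ
ρ ⊩ neg φ  = ¬ (ρ ⊩ φ)
ρ ⊩ φ & ψ  = (ρ ⊩ φ) × (ρ ⊩ ψ)
ρ ⊩ φ ⇒ ψ  = ρ ⊩ φ → ρ ⊩ ψ
ρ ⊩ all φ  = ∀ x → x ∷ ρ ⊩ φ

-- Sums are not terms of the target language, so a term becomes a formula saying that `z` is its
-- value; `σ` locates the source variables. Values of subterms are named by guarded universal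
-- quantifiers: each guard has exactly one solution, so these act as existential ones, with no
-- double negation to remove.
val : (Fin m → Fin n) → Tm m → Fin n → Formula n
val σ (var i) z = var z ≐ var (σ i)
val σ 𝟘       z = var z isZero
val σ 𝟙       z = all (var (1 ↑ʳ z) · var 0F ≐ var 0F)
val σ (s ⊕ t) z = all (all (val ((2 ↑ʳ_) ∘ σ) s 1F ⇒ val ((2 ↑ʳ_) ∘ σ) t 0F ⇒
                    isSum 1F 0F (2 ↑ʳ z)))
val σ (s ⊗ t) z = all (all (val ((2 ↑ʳ_) ∘ σ) s 1F ⇒ val ((2 ↑ʳ_) ∘ σ) t 0F ⇒
                    var (2 ↑ʳ z) ≐ var 1F · var 0F))

⊨-val : ∀ (σ : Fin m → Fin n) t z ρ ρᴺ → (∀ i → lookup ρ (σ i) ≡ + lookup ρᴺ i) →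
        (ρ ⊨ val σ t z) ⇔ (lookup ρ z ≡ + eval t ρᴺ)
⊨-val σ (var i) z ρ ρᴺ σ≡ = mk⇔ (λ eq → trans eq (σ≡ i)) (λ eq → trans eq (sym (σ≡ i)))
⊨-val σ 𝟘 z ρ ρᴺ σ≡ = ⊨-isZero (var z) ρ
⊨-val σ 𝟙 z ρ ρᴺ σ≡ = mk⇔
  (λ h → trans (sym (ℤ.*-identityʳ (lookup ρ z))) (h 1ℤ))
  (λ eq x → trans (cong (ℤ._* x) eq) (ℤ.*-identityˡ x))
⊨-val σ (s ⊕ t) z ρ ρᴺ σ≡ = mk⇔
  (λ h → to (⊨-isSum 1F 0F (2 ↑ʳ z) (+ b ∷ + a ∷ ρ) refl refl)
           (h (+ a) (+ b) (from (left (+ a) (+ b)) refl) (from (right (+ a) (+ b)) refl)))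
  (λ eq x y x≡ y≡ → from (⊨-isSum 1F 0F (2 ↑ʳ z) (y ∷ x ∷ ρ)
                           (to (left x y) x≡) (to (right x y) y≡)) eq)
  where
  a = eval s ρᴺ
  b = eval t ρᴺ
  left  = λ x y → ⊨-val ((2 ↑ʳ_) ∘ σ) s 1F (y ∷ x ∷ ρ) ρᴺ σ≡
  right = λ x y → ⊨-val ((2 ↑ʳ_) ∘ σ) t 0F (y ∷ x ∷ ρ) ρᴺ σ≡
⊨-val σ (s ⊗ t) z ρ ρᴺ σ≡ = mk⇔
  (λ h → trans (h (+ a) (+ b) (from (left (+ a) (+ b)) refl) (from (right (+ a) (+ b)) refl))
           (sym (ℤ.pos-* a b)))
  (λ eq x y x≡ y≡ → trans eq (trans (ℤ.pos-* a b)
                      (sym (cong₂ ℤ._*_ (to (left x y) x≡) (to (right x y) y≡)))))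
  where
  a = eval s ρᴺ
  b = eval t ρᴺ
  left  = λ x y → ⊨-val ((2 ↑ʳ_) ∘ σ) s 1F (y ∷ x ∷ ρ) ρᴺ σ≡
  right = λ x y → ⊨-val ((2 ↑ʳ_) ∘ σ) t 0F (y ∷ x ∷ ρ) ρᴺ σ≡

isNat : Fin n → Formula n
isNat i = all (var 0F isZero ⇒ var 0F ≼ var (1 ↑ʳ i))

⊨-isNat : ∀ (i : Fin n) ρ → (ρ ⊨ isNat i) ⇔ (0ℤ ℤ.≤ lookup ρ i)
⊨-isNat i ρ = mk⇔
  (λ h → h 0ℤ (from (⊨-isZero (var 0F) (0ℤ ∷ ρ)) refl))
  (λ 0≤ x x≡0 → subst (ℤ._≤ lookup ρ i) (sym (to (⊨-isZero (var 0F) (x ∷ ρ)) x≡0)) 0≤)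

tr : Fm n → Formula n
tr (s ≐ t) = all (all (val (2 ↑ʳ_) s 1F ⇒ val (2 ↑ʳ_) t 0F ⇒ var 1F ≐ var 0F))
tr (s ≼ t) = all (all (val (2 ↑ʳ_) s 1F ⇒ val (2 ↑ʳ_) t 0F ⇒ var 1F ≼ var 0F))
tr (neg φ) = neg (tr φ)
tr (φ & ψ) = tr φ ∧ tr ψ
tr (φ ⇒ ψ) = tr φ ⇒ tr ψ
tr (all φ) = all (isNat 0F ⇒ tr φ)

⊨-tr : ∀ (φ : Fm n) ρ ρᴺ → (∀ i → lookup ρ i ≡ + lookup ρᴺ i) → (ρ ⊨ tr φ) ⇔ (ρᴺ ⊩ φ)
⊨-tr (s ≐ t) ρ ρᴺ ρ≡ = mk⇔
  (λ h → ℤ.+-injective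
     (h (+ a) (+ b) (from (left (+ a) (+ b)) refl) (from (right (+ a) (+ b)) refl)))
  (λ eq x y x≡ y≡ → trans (to (left x y) x≡) (trans (cong +_ eq) (sym (to (right x y) y≡))))
  where
  a = eval s ρᴺ
  b = eval t ρᴺ
  left  = λ x y → ⊨-val (2 ↑ʳ_) s 1F (y ∷ x ∷ ρ) ρᴺ ρ≡
  right = λ x y → ⊨-val (2 ↑ʳ_) t 0F (y ∷ x ∷ ρ) ρᴺ ρ≡
⊨-tr (s ≼ t) ρ ρᴺ ρ≡ = mk⇔
  (λ h → ℤ.drop‿+≤+
     (h (+ a) (+ b) (from (left (+ a) (+ b)) refl) (from (right (+ a) (+ b)) refl)))
  (λ a≤b x y x≡ y≡ → subst₂ ℤ._≤_ (sym (to (left x y) x≡)) (sym (to (right x y) y≡))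
                       (ℤ.+≤+ a≤b))
  where
  a = eval s ρᴺ
  b = eval t ρᴺ
  left  = λ x y → ⊨-val (2 ↑ʳ_) s 1F (y ∷ x ∷ ρ) ρᴺ ρ≡
  right = λ x y → ⊨-val (2 ↑ʳ_) t 0F (y ∷ x ∷ ρ) ρᴺ ρ≡
⊨-tr (neg φ) ρ ρᴺ ρ≡ = mk⇔ (λ h → h ∘ from ih) (λ h → h ∘ to ih)
  where ih = ⊨-tr φ ρ ρᴺ ρ≡
⊨-tr (φ & ψ) ρ ρᴺ ρ≡ = mk⇔
  (λ h → let p , q = to (⊨-∧ (tr φ) (tr ψ) ρ) h in
     to (⊨-tr φ ρ ρᴺ ρ≡) p , to (⊨-tr ψ ρ ρᴺ ρ≡) q)
  (λ (p , q) → from (⊨-∧ (tr φ) (tr ψ) ρ)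
     (from (⊨-tr φ ρ ρᴺ ρ≡) p , from (⊨-tr ψ ρ ρᴺ ρ≡) q))
⊨-tr (φ ⇒ ψ) ρ ρᴺ ρ≡ = mk⇔
  (λ h → to (⊨-tr ψ ρ ρᴺ ρ≡) ∘ h ∘ from (⊨-tr φ ρ ρᴺ ρ≡))
  (λ h → from (⊨-tr ψ ρ ρᴺ ρ≡) ∘ h ∘ to (⊨-tr φ ρ ρᴺ ρ≡))
⊨-tr (all φ) ρ ρᴺ ρ≡ = mk⇔
  (λ h x → to (ih x) (h (+ x) (from (⊨-isNat 0F (+ x ∷ ρ)) (ℤ.+≤+ z≤n))))
  (λ { h (+ x) _ → from (ih x) (h x)
     ; h -[1+ x ] nat → contradiction (to (⊨-isNat 0F (-[1+ x ] ∷ ρ)) nat) λ () })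
  where
  ih = λ x → ⊨-tr φ (+ x ∷ ρ) (x ∷ ρᴺ) λ { zero → refl ; (suc i) → ρ≡ i }

-- Finite sets of numbers

-- The moduli of Gödel's β-function, used here through divisibility alone, to code sets rather than
-- sequences.
modulus : ℕ → ℕ → ℕ
modulus b i = 1 + (1 + i) * b

-- The moduli of the numbers i ≤ c are pairwise coprime when b = c!, so the
-- product of some of them is divisible by no others.
Mem : ℕ → ℕ → ℕ → ℕ → Set
Mem a b c j = j ≤ c × modulus b j ∣ a

-- A common divisor divides (1 + j) mᵢ - (1 + i) mⱼ = j - i, which lies between 1 and c. It
-- therefore divides `c !`, and so also mᵢ - (1 + i) c! = 1.
<⇒modulus-coprime : ∀ {c i j} → i < j → j ≤ c → Coprime (modulus (c !) i) (modulus (c !) j)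
<⇒modulus-coprime {c} {i} {j} i<j j≤c {d} (d∣mᵢ , d∣mⱼ) = ∣1⇒≡1 d∣1
  where
  o = proj₁ (m≤n⇒∃[o]m+o≡n i<j)
  i+o≡j : suc i + o ≡ j
  i+o≡j = proj₂ (m≤n⇒∃[o]m+o≡n i<j)
  difference : ∀ i o b → (2 + i + o) * (1 + (1 + i) * b) ≡
                         (1 + i) * (1 + (2 + i + o) * b) + (1 + o)
  difference = ℕSolver.solve-∀
  d∣1+o : d ∣ 1 + o
  d∣1+o = ∣m+n∣m⇒∣n
    (subst (d ∣_) (difference i o (c !)) (∣n⇒∣m*n (2 + i + o) d∣mᵢ))
    (∣n⇒∣m*n (1 + i) (subst (λ j → d ∣ modulus (c !) j) (sym i+o≡j) d∣mⱼ))
  1+o≤c : 1 + o ≤ c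
  1+o≤c = ≤-trans (s≤s (m≤n+m o i)) (≤-trans (≤-reflexive i+o≡j) j≤c)
  d∣c! : d ∣ c !
  d∣c! = ∣-trans d∣1+o (∣-trans (m∣m*n (o !)) (m≤n⇒m!∣n! 1+o≤c))
  d∣1 : d ∣ 1
  d∣1 = ∣m+n∣m⇒∣n (subst (d ∣_) (+-comm 1 _) d∣mᵢ) (∣n⇒∣m*n (1 + i) d∣c!)

modulus-coprime : ∀ {c i j} → i ≢ j → i ≤ c → j ≤ c →
                  Coprime (modulus (c !) i) (modulus (c !) j)
modulus-coprime {i = i} {j} i≢j i≤c j≤c with <-cmp i j
... | tri< i<j _ _ = <⇒modulus-coprime i<j j≤c
... | tri≈ _ i≡j _ = contradiction i≡j i≢j
... | tri> _ _ j<i = Coprime.sym (<⇒modulus-coprime j<i i≤c)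

∈⇒≤sum : ∀ {j is} → j ∈ is → j ≤ sum is
∈⇒≤sum (here refl) = m≤m+n _ _
∈⇒≤sum {is = i ∷ is} (there j∈is) = m≤n⇒m≤o+n i (∈⇒≤sum j∈is)

-- Factors with index other than j are coprime to the modulus of j and can be stripped off one by
-- one. The empty product is never reached with divisibility intact, because the modulus exceeds 1
-- as `c !` is positive.
modulus∣product⇒∈ : ∀ {c j} is → (∀ {i} → i ∈ is → i ≤ c) → j ≤ c →
                    modulus (c !) j ∣ product (List.map (modulus (c !)) is) → j ∈ is
modulus∣product⇒∈ {c} {j} [] _ _ m∣1 =
  contradiction (suc-injective (∣1⇒≡1 m∣1)) (>⇒≢ (*-mono-≤ (s≤s (z≤n {j})) (1≤n! c)))
modulus∣product⇒∈ {c} {j} (i ∷ is) is≤c j≤c m∣ with j ≟ i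
... | yes j≡i = here j≡i
... | no  j≢i = there (modulus∣product⇒∈ is (is≤c ∘ there) j≤c
                  (coprime-divisor (modulus-coprime j≢i j≤c (is≤c (here refl))) m∣))

-- The sum serves as a bound on all members. Repeated members do no harm, as only divisibility by a
-- single modulus is tested.
code-list : ∀ is → ∃ λ a → ∃ λ b → ∃ λ c → ∀ j → Mem a b c j ⇔ j ∈ is
code-list is = product (List.map (modulus (c !)) is) , c ! , c , λ j → mk⇔
  (λ (j≤c , m∣a) → modulus∣product⇒∈ is ∈⇒≤sum j≤c m∣a)
  (λ j∈is → ∈⇒≤sum j∈is , ∈⇒∣product (∈-map⁺ (modulus (c !)) j∈is))
  where c = sum is

-- Arithmetical definitions of the partial recursive functions

pair : Tm n → Tm n → Tm n
pair s t = (s ⊕ t) ⊗ (s ⊕ t) ⊕ s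

mem : (a b c i r : Fin n) → Fm n
mem a b c i r =
  (pair (var i) (var r) ≼ var c) &
  neg (all (neg (var (suc a) ≐
    var 0F ⊗ (𝟙 ⊕ (𝟙 ⊕ pair (var (suc i)) (var (suc r))) ⊗ var (suc b)))))

-- Divisibility is decidable, which removes the double negation in front of the quotient.
⊩-mem : ∀ (a b c i r : Fin n) ρ →
  (ρ ⊩ mem a b c i r) ⇔
  Mem (lookup ρ a) (lookup ρ b) (lookup ρ c) ⟨ lookup ρ i , lookup ρ r ⟩
⊩-mem a b c i r ρ = mk⇔
  (λ (j≤c , ¬¬m∣a) → j≤c , decidable-stable (_ ∣? lookup ρ a)
     (λ ¬m∣a → ¬¬m∣a (λ q eq → ¬m∣a (divides q eq))))
  (λ { (j≤c , divides q eq) → j≤c , λ h → h q eq })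

alls : ∀ m → Fm (m + n) → Fm n
alls zero    φ = φ
alls (suc m) φ = alls m (all φ)

⊩-alls : ∀ m (φ : Fm (m + n)) ρ → (ρ ⊩ alls m φ) ⇔ (∀ xs → xs ++ ρ ⊩ φ)
⊩-alls zero    φ ρ = mk⇔ (λ { h [] → h }) (λ h → h [])
⊩-alls (suc m) φ ρ = mk⇔
  (λ { h (x ∷ xs) → to (⊩-alls m (all φ) ρ) h xs x })
  (λ h → from (⊩-alls m (all φ) ρ) λ xs x → h (x ∷ xs))

-- A primitive recursion is defined as the least relation that contains its
-- starting value and is closed under its steps. Quantifying over the finite
-- relations coded by a, b, c suffices since computations are finite.
mutual
  graph : Rec k → (Fin k → Fin n) → Fin n → Fm n
  graph zer      is j = var j ≐ 𝟘
  graph succ     is j = var j ≐ 𝟙 ⊕ var (is 0F)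
  graph (proj p) is j = var j ≐ var (is p)
  graph {n = n} (comp {m} f gs) is j =
    alls m (graphs gs ((m ↑ʳ_) ∘ is) (_↑ˡ n) (graph f (_↑ˡ n) (m ↑ʳ j)))
  graph (prec f g) is j = all (all (all (
    all (all (
      var 1F ≐ 𝟘 ⇒ graph f ((5 ↑ʳ_) ∘ is ∘ suc) 0F ⇒ mem 4F 3F 2F 1F 0F)) ⇒
    all (all (all (all (
      -- From the outside in, the four quantifiers bind i, i′ = 1 + i, r and s. The bound on i′ asks
      -- for closure only up to the recursion argument; without it no finite relation containing a
      -- starting value could be closed under a total step.
      var 2F ≐ 𝟙 ⊕ var 3F ⇒ var 2F ≼ var (7 ↑ʳ is 0F) ⇒ mem 6F 5F 4F 3F 1F ⇒
      graph g (3F Vector.∷ 1F Vector.∷ (7 ↑ʳ_) ∘ is ∘ suc) 0F ⇒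
      mem 6F 5F 4F 2F 0F)))) ⇒
    mem 2F 1F 0F (3 ↑ʳ is 0F) (3 ↑ʳ j))))
  -- The value of a graph must be a variable, so the constant 0 is bound to one first.
  graph (mu f) is j = all (var 0F ≐ 𝟘 ⇒
    graph f (suc j Vector.∷ suc ∘ is) 0F &
    all (𝟙 ⊕ var 0F ≼ var (2 ↑ʳ j) ⇒ neg (graph f (0F Vector.∷ (2 ↑ʳ_) ∘ is) 1F)))

  graphs : Vec (Rec k) m → (Fin k → Fin n) → (Fin m → Fin n) → Fm n → Fm n
  graphs []       is js φ = φ
  graphs (g ∷ gs) is js φ = graph g is (js zero) ⇒ graphs gs is (js ∘ suc) φ

-- Traces of primitive recursions

module _ {f : Rec n} {g : Rec (2 + n)} {xs : Vec ℕ n} where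

  trace : ∀ {y} → prec f g [ k ∷ xs ]⇓ y → List ℕ
  trace {y = y} (prec⇓₀ _)           = ⟨ 0 , y ⟩ ∷ []
  trace {y = y} (prec⇓₊ {k = k} d _) = ⟨ suc k , y ⟩ ∷ trace d

  trace-bounded : ∀ {y i r} (d : prec f g [ k ∷ xs ]⇓ y) → ⟨ i , r ⟩ ∈ trace d → i ≤ k
  trace-bounded {i = i} {r} (prec⇓₀ {y = y} _) (here eq) =
    ≤-reflexive (proj₁ (⟨,⟩-injective i r 0 y eq))
  trace-bounded {i = i} {r} (prec⇓₊ {k = k} {y = y} _ _) (here eq) =
    ≤-reflexive (proj₁ (⟨,⟩-injective i r (suc k) y eq))
  trace-bounded (prec⇓₊ d _) (there p) = m≤n⇒m≤1+n (trace-bounded d p)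

  trace-end : ∀ {y r} (d : prec f g [ k ∷ xs ]⇓ y) → ⟨ k , r ⟩ ∈ trace d → r ≡ y
  trace-end {r = r} (prec⇓₀ {y = y} _) (here eq) = proj₂ (⟨,⟩-injective 0 r 0 y eq)
  trace-end {r = r} (prec⇓₊ {k = k} {y = y} _ _) (here eq) =
    proj₂ (⟨,⟩-injective (suc k) r (suc k) y eq)
  trace-end (prec⇓₊ d _) (there p) = contradiction (trace-bounded d p) 1+n≰n

  trace-start : ∀ {y} (d : prec f g [ k ∷ xs ]⇓ y) →
                ∃ λ r → f [ xs ]⇓ r × ⟨ 0 , r ⟩ ∈ trace d
  trace-start (prec⇓₀ {y = y} e) = y , e , here refl
  trace-start (prec⇓₊ d _) = let r , e , p = trace-start d in r , e , there p

  trace-step : ∀ {y i r} (d : prec f g [ k ∷ xs ]⇓ y) → ⟨ i , r ⟩ ∈ trace d → i < k →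
               ∃ λ s → g [ i ∷ r ∷ xs ]⇓ s × ⟨ suc i , s ⟩ ∈ trace d
  trace-step {i = i} {r} (prec⇓₊ {k = k} {y = y} d e) (here eq) i<1+k =
    contradiction (proj₁ (⟨,⟩-injective i r (suc k) y eq)) (<⇒≢ i<1+k)
  trace-step {i = i} (prec⇓₊ {k = k} {y = y} d e) (there p) i<1+k with i ≟ k
  -- An entry at the last stage of the inner trace carries that trace's value, so the present step
  -- `e` continues it.
  ... | yes refl = y , subst (λ r → g [ k ∷ r ∷ xs ]⇓ y) (sym (trace-end d p)) e , here refl
  ... | no  i≢k  = let s , e′ , q = trace-step d p (≤∧≢⇒< (≤-pred i<1+k) i≢k)
                   in s , e′ , there q

  -- Minimality of the computed relation, by induction on the computation. Closure is assumed only
  -- below `k`, matching the bound in the formula.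
  prec-least : (P : ℕ → ℕ → Set) →
    (∀ {r} → f [ xs ]⇓ r → P 0 r) →
    (∀ {i r s} → i < k → P i r → g [ i ∷ r ∷ xs ]⇓ s → P (suc i) s) →
    ∀ {y} → prec f g [ k ∷ xs ]⇓ y → P k y
  prec-least P start step (prec⇓₀ e)   = start e
  prec-least P start step (prec⇓₊ d e) =
    step ≤-refl (prec-least P start (step ∘ m≤n⇒m≤1+n) d) e

-- Correctness of the graph formulas

mutual
  -- The claim is restricted to halting computations. Their subcomputations halt as well, so the
  -- induction runs over the computation; for `mu` this includes the nonzero values below the root.
  ⊩-graph : ∀ (f : Rec k) {xs y} → f [ xs ]⇓ y → ∀ is (j : Fin n) ρ →
            (∀ p → lookup ρ (is p) ≡ lookup xs p) →
            (ρ ⊩ graph f is j) ⇔ (lookup ρ j ≡ y)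
  ⊩-graph zer zer⇓ is j ρ is≡ = mk⇔ id id
  ⊩-graph succ {x ∷ []} succ⇓ is j ρ is≡ = mk⇔
    (λ eq → trans eq (cong suc (is≡ 0F)))
    (λ eq → trans eq (cong suc (sym (is≡ 0F))))
  ⊩-graph (proj p) proj⇓ is j ρ is≡ = mk⇔
    (λ eq → trans eq (is≡ p))
    (λ eq → trans eq (sym (is≡ p)))
  ⊩-graph {n = n} (comp {m} f gs) (comp⇓ {ys = ys} ds d) is j ρ is≡ = mk⇔
    (λ h → trans (sym (lookup-++ʳ ys ρ j))
       (to (value ys (lookup-++ˡ ys ρ))
         (to (arguments ys) (to (⊩-alls m body ρ) h ys) (lookup-++ˡ ys ρ))))
    (λ eq → from (⊩-alls m body ρ) λ zs → from (arguments zs) λ zs≡ →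
       from (value zs zs≡) (trans (lookup-++ʳ zs ρ j) eq))
    where
    result = graph f (_↑ˡ n) (m ↑ʳ j)
    body = graphs gs ((m ↑ʳ_) ∘ is) (_↑ˡ n) result
    arguments = λ zs → ⊩-graphs gs ds ((m ↑ʳ_) ∘ is) (_↑ˡ n) result (zs ++ ρ)
                         λ p → trans (lookup-++ʳ zs ρ (is p)) (is≡ p)
    value = λ zs zs≡ → ⊩-graph f d (_↑ˡ n) (m ↑ʳ j) (zs ++ ρ) zs≡
  ⊩-graph (prec f g) {k ∷ xs} {y} d is j ρ is≡ = mk⇔ sound complete
    where
    ih-f = λ (a b c i r : ℕ) {v} (e : f [ xs ]⇓ v) →
      ⊩-graph f e ((5 ↑ʳ_) ∘ is ∘ suc) 0F (r ∷ i ∷ c ∷ b ∷ a ∷ ρ) (is≡ ∘ suc)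
    ih-g = λ (a b c i i′ r s : ℕ) {v} (e : g [ i ∷ r ∷ xs ]⇓ v) →
      ⊩-graph g e (3F Vector.∷ 1F Vector.∷ (7 ↑ʳ_) ∘ is ∘ suc) 0F
        (s ∷ r ∷ i′ ∷ i ∷ c ∷ b ∷ a ∷ ρ)
        λ { zero → refl ; (suc zero) → refl ; (suc (suc p)) → is≡ (suc p) }

    sound : ρ ⊩ graph (prec f g) is j → lookup ρ j ≡ y
    -- The trace, coded as a set, contains the start and is closed under the steps, so the formula
    -- puts the pair of recursion argument and output into it. The only entry at the last stage has
    -- value y.
    sound h = trace-end d (to (coded _) (subst (λ k → Mem a b c ⟨ k , lookup ρ j ⟩) (is≡ 0F)
      (to (⊩-mem 2F 1F 0F (3 ↑ʳ is 0F) (3 ↑ʳ j) (c ∷ b ∷ a ∷ ρ)) (h a b c start step))))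
      where
      code = code-list (trace d)
      a = proj₁ code
      b = proj₁ (proj₂ code)
      c = proj₁ (proj₂ (proj₂ code))
      coded = proj₂ (proj₂ (proj₂ code))
      start = λ i r i≡0 hf → let v , e , p = trace-start d in
        from (⊩-mem 4F 3F 2F 1F 0F (r ∷ i ∷ c ∷ b ∷ a ∷ ρ)) (from (coded _)
          (subst₂ (λ i r → ⟨ i , r ⟩ ∈ trace d) (sym i≡0)
            (sym (to (ih-f a b c i r e) hf)) p))
      step = λ i i′ r s i′≡1+i i′≤k m hg →
        let v , e , p = trace-step d
              (to (coded _) (to (⊩-mem 6F 5F 4F 3F 1F (s ∷ r ∷ i′ ∷ i ∷ c ∷ b ∷ a ∷ ρ)) m))
              (subst₂ _≤_ i′≡1+i (is≡ 0F) i′≤k) in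
        from (⊩-mem 6F 5F 4F 2F 0F (s ∷ r ∷ i′ ∷ i ∷ c ∷ b ∷ a ∷ ρ)) (from (coded _)
          (subst₂ (λ i r → ⟨ i , r ⟩ ∈ trace d) (sym i′≡1+i)
            (sym (to (ih-g a b c i i′ r s e) hg)) p))

    complete : lookup ρ j ≡ y → ρ ⊩ graph (prec f g) is j
    complete eq a b c start step =
      from (⊩-mem 2F 1F 0F (3 ↑ʳ is 0F) (3 ↑ʳ j) (c ∷ b ∷ a ∷ ρ))
        (subst₂ (λ k y → Mem a b c ⟨ k , y ⟩) (sym (is≡ 0F)) (sym eq)
          (prec-least (λ i r → Mem a b c ⟨ i , r ⟩)
            (λ {r} e → to (⊩-mem 4F 3F 2F 1F 0F (r ∷ 0 ∷ c ∷ b ∷ a ∷ ρ))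
              (start 0 r refl (from (ih-f a b c 0 r e) refl)))
            (λ {i} {r} {s} i<k m e →
              let ρ′ = s ∷ r ∷ suc i ∷ i ∷ c ∷ b ∷ a ∷ ρ in
              to (⊩-mem 6F 5F 4F 2F 0F ρ′)
                (step i (suc i) r s refl (subst (i <_) (sym (is≡ 0F)) i<k)
                  (from (⊩-mem 6F 5F 4F 3F 1F ρ′) m)
                  (from (ih-g a b c i (suc i) r s e) refl)))
            d))
  ⊩-graph (mu f) {xs} {y} (mu⇓ d below) is j ρ is≡ = mk⇔ sound complete
    where
    root = λ {x v} (e : f [ x ∷ xs ]⇓ v) (x≡ : lookup ρ j ≡ x) →
      ⊩-graph f e (suc j Vector.∷ suc ∘ is) 0F (0 ∷ ρ) λ { zero → x≡ ; (suc p) → is≡ p }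
    smaller = λ {x v} (e : f [ x ∷ xs ]⇓ v) →
      ⊩-graph f e (0F Vector.∷ (2 ↑ʳ_) ∘ is) 1F (x ∷ 0 ∷ ρ) λ { zero → refl ; (suc p) → is≡ p }

    sound : ρ ⊩ graph (mu f) is j → lookup ρ j ≡ y
    sound h with <-cmp (lookup ρ j) y
    ... | tri≈ _ j≡y _ = j≡y
    ... | tri< j<y _ _ = contradiction
      (to (root (proj₂ (below _ j<y)) refl) (proj₁ (h 0 refl))) λ ()
    ... | tri> _ _ y<j = contradiction (from (smaller d) refl) (proj₂ (h 0 refl) y y<j)

    complete : lookup ρ j ≡ y → ρ ⊩ graph (mu f) is j
    complete j≡y _ refl =
      from (root d j≡y) refl ,
      λ x x<j h → contradiction (to (smaller (proj₂ (below x (subst (x <_) j≡y x<j)))) h) λ ()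

  ⊩-graphs : ∀ (gs : Vec (Rec k) m) {xs ys} → Pointwise (λ g y → g [ xs ]⇓ y) gs ys →
             ∀ is js (φ : Fm n) ρ → (∀ p → lookup ρ (is p) ≡ lookup xs p) →
             (ρ ⊩ graphs gs is js φ) ⇔
             ((∀ q → lookup ρ (js q) ≡ lookup ys q) → ρ ⊩ φ)
  ⊩-graphs [] [] is js φ ρ is≡ = mk⇔ (λ h _ → h) (λ h → h λ ())
  ⊩-graphs (g ∷ gs) (d ∷ ds) is js φ ρ is≡ = mk⇔
    (λ h js≡ → to rest (h (from first (js≡ zero))) (js≡ ∘ suc))
    (λ h hg → from rest λ js≡ → h λ { zero → to first hg ; (suc q) → js≡ q })
    where
    first = ⊩-graph g d is (js zero) ρ is≡
    rest  = ⊩-graphs gs ds is (js ∘ suc) φ ρ is≡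

-- Numerals and the diagonal function

-- Each layer passes to the predecessor and adds the same prefix, with the same indices at every
-- depth. The code is thus a plain primitive recursion in the number.
numeral : ℕ → Formula (suc m)
numeral zero    = var 0F isZero
numeral (suc k) = all (var 1F isSucOf var 0F ⇒ numeral k)

⊨-numeral : ∀ k x (ρ : Vec ℤ m) → (x ∷ ρ ⊨ numeral k) ⇔ (x ≡ + k)
⊨-numeral zero    x ρ = ⊨-isZero (var 0F) (x ∷ ρ)
⊨-numeral (suc k) x ρ = mk⇔
  (λ h → trans (sym (ℤ.suc-pred x))
     (cong ℤ.suc (to (⊨-numeral k (ℤ.pred x) (x ∷ ρ))
       (h (ℤ.pred x) (from (isSuc (ℤ.pred x)) (sym (ℤ.suc-pred x)))))))
  (λ x≡ y x≡1+y → from (⊨-numeral k y (x ∷ ρ))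
     (trans (sym (ℤ.pred-suc y)) (cong ℤ.pred (trans (sym (to (isSuc y) x≡1+y)) x≡))))
  where
  isSuc = λ y → ⊨-isSucOf (var 1F) (var 0F) (y ∷ x ∷ ρ)

-- A guarded quantifier takes the place of substitution, so the code of the instance arises from the
-- code of `φ` by pairing alone.
at : Formula 1 → ℕ → Sentence
at φ k = all (numeral k ⇒ φ)

⊨-at : ∀ φ k → True (at φ k) ⇔ (+ k ∷ [] ⊨ φ)
⊨-at φ k = mk⇔
  (λ h → h (+ k) (from (⊨-numeral k (+ k) []) refl))
  (λ h x x≡k → subst (λ x → x ∷ [] ⊨ φ) (sym (to (⊨-numeral k x []) x≡k)) h)

-- Opaque because Agda would compare these large numbers in unary.
opaque
  code : Formula n → ℕ
  code = ⌜_⌝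

  code≡⌜⌝ : ∀ (φ : Formula n) → code φ ≡ ⌜ φ ⌝
  code≡⌜⌝ φ = refl

  code-∀⇒ : ℕ → ℕ → ℕ
  code-∀⇒ a b = ⟨ 4 , ⟨ 3 , ⟨ a , b ⟩ ⟩ ⟩

  code-isZero code-isSuc : ℕ
  code-isZero = ⌜ var {1} 0F isZero ⌝
  code-isSuc  = ⌜ var {2} 1F isSucOf var 0F ⌝

  code≡code-∀⇒ : ∀ (φ ψ : Formula (suc n)) → code (all (φ ⇒ ψ)) ≡ code-∀⇒ (code φ) (code ψ)
  code≡code-∀⇒ φ ψ = refl

  code≡code-isZero : ∀ m → code (var {1 + m} 0F isZero) ≡ code-isZero
  code≡code-isZero m = refl

  code≡code-isSuc : ∀ m → code (var {2 + m} 1F isSucOf var 0F) ≡ code-isSuc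
  code≡code-isSuc m = refl

code-numeral : ℕ → ℕ
code-numeral zero    = code-isZero
code-numeral (suc k) = code-∀⇒ code-isSuc (code-numeral k)

code≡code-numeral : ∀ m k → code (numeral {m} k) ≡ code-numeral k
code≡code-numeral m zero    = code≡code-isZero m
code≡code-numeral m (suc k) =
  trans (code≡code-∀⇒ (var 1F isSucOf var 0F) (numeral k))
    (cong₂ code-∀⇒ (code≡code-isSuc m) (code≡code-numeral (suc m) k))

code-at : ∀ φ k → code (at φ k) ≡ code-∀⇒ (code-numeral k) (code φ)
code-at φ k = trans (code≡code-∀⇒ (numeral k) φ)
  (cong (λ a → code-∀⇒ a (code φ)) (code≡code-numeral 0 k))

-- Recursive functions on codes

const : ℕ → Rec n
const zero    = comp zer []
const (suc k) = comp succ (const k ∷ [])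

const⇓ : ∀ k {xs : Vec ℕ n} → const k [ xs ]⇓ k
const⇓ zero    = comp⇓ [] zer⇓
const⇓ (suc k) = comp⇓ (const⇓ k ∷ []) succ⇓

add mul pairing ∀⇒-code : Rec 2
add = prec (proj 0F) (comp succ (proj 1F ∷ []))
mul = prec (const 0) (comp add (proj 2F ∷ proj 1F ∷ []))
pairing = comp add (comp mul (add ∷ add ∷ []) ∷ proj 0F ∷ [])
∀⇒-code = comp pairing (const 4 ∷ comp pairing (const 3 ∷ pairing ∷ []) ∷ [])

add⇓ : ∀ x y → add [ x ∷ y ∷ [] ]⇓ x + y
add⇓ zero    y = prec⇓₀ proj⇓
add⇓ (suc x) y = prec⇓₊ (add⇓ x y) (comp⇓ (proj⇓ ∷ []) succ⇓)

mul⇓ : ∀ x y → mul [ x ∷ y ∷ [] ]⇓ x * y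
mul⇓ zero    y = prec⇓₀ (const⇓ 0)
mul⇓ (suc x) y = prec⇓₊ (mul⇓ x y) (comp⇓ (proj⇓ ∷ proj⇓ ∷ []) (add⇓ y (x * y)))

pairing⇓ : ∀ x y → pairing [ x ∷ y ∷ [] ]⇓ ⟨ x , y ⟩
pairing⇓ x y = comp⇓
  (comp⇓ (add⇓ x y ∷ add⇓ x y ∷ []) (mul⇓ (x + y) (x + y)) ∷ proj⇓ ∷ [])
  (add⇓ ((x + y) * (x + y)) x)

opaque
  unfolding code-∀⇒

  ∀⇒-code⇓ : ∀ a b → ∀⇒-code [ a ∷ b ∷ [] ]⇓ code-∀⇒ a b
  ∀⇒-code⇓ a b = comp⇓
    (const⇓ 4 ∷ comp⇓ (const⇓ 3 ∷ pairing⇓ a b ∷ []) (pairing⇓ 3 ⟨ a , b ⟩) ∷ [])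
    (pairing⇓ 4 ⟨ 3 , ⟨ a , b ⟩ ⟩)

numeral-code diagonal : Rec 1
numeral-code = prec (const code-isZero) (comp ∀⇒-code (const code-isSuc ∷ proj 1F ∷ []))
diagonal = comp ∀⇒-code (numeral-code ∷ proj 0F ∷ [])

numeral-code⇓ : ∀ k → numeral-code [ k ∷ [] ]⇓ code-numeral k
numeral-code⇓ zero    = prec⇓₀ (const⇓ code-isZero)
numeral-code⇓ (suc k) = prec⇓₊ (numeral-code⇓ k)
  (comp⇓ (const⇓ code-isSuc ∷ proj⇓ ∷ []) (∀⇒-code⇓ code-isSuc (code-numeral k)))

diagonal⇓ : ∀ φ → diagonal [ code φ ∷ [] ]⇓ code (at φ (code φ))
diagonal⇓ φ = subst (diagonal [ code φ ∷ [] ]⇓_) (sym (code-at φ (code φ)))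
  (comp⇓ (numeral-code⇓ (code φ) ∷ proj⇓ ∷ []) (∀⇒-code⇓ (code-numeral (code φ)) (code φ)))

-- The liar sentence

vanishes : Rec 1 → Formula 1
vanishes h = tr (all (var 0F ≐ 𝟘 ⇒ graph h (λ _ → 1F) 0F))

⊨-vanishes : ∀ (h : Rec 1) {x y} → h [ x ∷ [] ]⇓ y → (+ x ∷ [] ⊨ vanishes h) ⇔ (0 ≡ y)
⊨-vanishes h {x} h⇓y = mk⇔
  (λ p → to graph⇔ (to tr⇔ p 0 refl))
  (λ 0≡y → from tr⇔ λ { _ refl → from graph⇔ 0≡y })
  where
  tr⇔ = ⊨-tr (all (var 0F ≐ 𝟘 ⇒ graph h (λ _ → 1F) 0F)) (+ x ∷ []) (x ∷ [])
          λ { zero → refl }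
  graph⇔ = ⊩-graph h h⇓y (λ _ → 1F) 0F (0 ∷ x ∷ []) λ { zero → refl }

liar : ∀ f → ∃ λ S → ∀ {y} → f [ ⌜ S ⌝ ∷ [] ]⇓ y → True S ⇔ (0 ≡ y)
liar f = S , λ {y} f⇓y →
  -- On the code of `φ`, `h` first computes the code of `S` and then runs `f` on it, so it halts
  -- with the same value.
  let h⇓y = comp⇓ (diagonal⇓ φ ∷ []) (subst (λ s → f [ s ∷ [] ]⇓ y) (sym (code≡⌜⌝ S)) f⇓y)
      φ⇔  = ⊨-vanishes h h⇓y
  in mk⇔ (to φ⇔ ∘ to (⊨-at φ (code φ))) (from (⊨-at φ (code φ)) ∘ from φ⇔)
  where
  h = comp f (diagonal ∷ [])
  φ = vanishes h
  S = at φ (code φ)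

mainTheorem2 : Undecidable True
mainTheorem2 (f , decides) = ¬true (from (S⇔ (proj₂ (decides S) ¬true)) refl)
  where
  S = proj₁ (liar f)
  S⇔ = proj₂ (liar f)
  -- Were `S` true, `f` would answer 1, whereas `S` asserts the answer 0. With truth refuted, `f`
  -- must answer 0, which makes `S` true after all; no case distinction on the truth of `S` occurs.
  ¬true : ¬ True S
  ¬true t = contradiction (to (S⇔ (proj₁ (decides S) t)) t) λ ()
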